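{- Let $r\geq 3$ be an integer and $F$ a graph with $\chi(F)>r$. If $s$ and $n$ are sufficiently large, then $$\mathrm{ex}(n, K_r,\{F, M_{s+1}\})=\mathcal{N}(K_r,D_F(s,r)\vee I_{n-s}).$$
   Context: All graphs are finite and simple. $\mathcal{N}(H,G)$ is the number of copies of $H$ in $G$. For a family $\mathcal{F}$, a graph is $\mathcal{F}$-free if it contains no member of $\mathcal{F}$ as a subgraph; $\mathrm{ex}(n,H,\mathcal{F})$ is the maximum of $\mathcal{N}(H,G)$ over $n$-vertex $\mathcal{F}$-free graphs $G$, and $\mathrm{EX}(n,H,\mathcal{F})$ is the set of $n$-vertex $\mathcal{F}$-free graphs attaining it. $M_{s+1}$ is a matching of $s+1$ edges, $I_m$ the edgeless graph on $m$ vertices, $\vee$ the join. $\mathcal{D}(F)$ is the set of all graphs obtained from $F$ by deleting an independent set of $F$. $D_F(s,r)$ denotes a graph in $\mathrm{EX}(s,K_{r-1},\mathcal{D}(F))$ with the maximum number of copies of $K_r$. -}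

module Defs where

open import Data.Nat using (ℕ; zero; suc; _+_; _∸_; _≤_)
open import Data.Bool using (Bool; true; false; T)
open import Data.Bool.Properties using () renaming (_≟_ to _≟ᵇ_)
open import Data.Fin using (Fin; splitAt; _≟_)
open import Data.Fin.Properties using (all?)
open import Data.Fin.Subset using (Subset; _∈_; _∉_; ∣_∣)
open import Data.Fin.Subset.Properties using (_∈?_)
open import Data.Vec using ([]; _∷_)
open import Data.List using (List; []; _∷_; map; _++_; length; filter)
open import Data.Sum using (_⊎_; inj₁; inj₂)
open import Data.Product using (Σ; ∃; _×_; _,_)
open import Function.Definitions using (Injective)
open import Relation.Nullary using (¬_; Dec; yes; no; ¬?; _×-dec_; _→-dec_)
open import Relation.Nullary.Decidable using (⌊_⌋)
open import Relation.Binary.PropositionalEquality using (_≡_; _≢_; refl; sym)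

record Graph (n : ℕ) : Set where
  field
    adj    : Fin n → Fin n → Bool
    adj-sym    : ∀ i j → adj i j ≡ adj j i
    adj-irrefl : ∀ i → adj i i ≡ false
open Graph public

Edge : ∀ {n} → Graph n → Fin n → Fin n → Set
Edge G i j = adj G i j ≡ true

-- A "pattern" graph on an arbitrary vertex type V (used for subgraphs
-- of F obtained by deleting vertices).  H is a subgraph of G (G contains
-- a copy of H) iff there is an injective edge-preserving map V → Fin n.
ContainsOn : ∀ {n} (V : Set) → (V → V → Set) → Graph n → Set
ContainsOn {n} V E G =
  Σ (V → Fin n) λ g → Injective _≡_ _≡_ g × (∀ u v → E u v → Edge G (g u) (g v))

Contains : ∀ {h n} → Graph h → Graph n → Set
Contains {h} H G = ContainsOn (Fin h) (Edge H) G

ProperColouring : ∀ {f} → Graph f → (r : ℕ) → (Fin f → Fin r) → Set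
ProperColouring F r c = ∀ i j → Edge F i j → c i ≢ c j

ChromaticGreaterThan : ∀ {f} → Graph f → ℕ → Set
ChromaticGreaterThan F r = ¬ (Σ (Fin _ → Fin r) (ProperColouring F r))

Independent : ∀ {f} → Graph f → Subset f → Set
Independent F I = ∀ i j → i ∈ I → j ∈ I → ¬ Edge F i j

Rest : ∀ {f} → Subset f → Set
Rest {f} I = Σ (Fin f) λ v → v ∉ I

RestEdge : ∀ {f} (F : Graph f) (I : Subset f) → Rest I → Rest I → Set
RestEdge F I (u , _) (v , _) = Edge F u v

DFree : ∀ {f n} → Graph f → Graph n → Set
DFree F G = ∀ (I : Subset _) → Independent F I → ¬ ContainsOn (Rest I) (RestEdge F I) G

matchAdj⊎ : ∀ {k} → Fin k ⊎ Fin k → Fin k ⊎ Fin k → Bool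
matchAdj⊎ (inj₁ i) (inj₂ j) = ⌊ i ≟ j ⌋
matchAdj⊎ (inj₂ i) (inj₁ j) = ⌊ i ≟ j ⌋
matchAdj⊎ (inj₁ _) (inj₁ _) = false
matchAdj⊎ (inj₂ _) (inj₂ _) = false

private
  ≟-sym : ∀ {k} (i j : Fin k) → ⌊ i ≟ j ⌋ ≡ ⌊ j ≟ i ⌋
  ≟-sym i j with i ≟ j | j ≟ i
  ... | yes _  | yes _ = refl
  ... | no  _  | no  _ = refl
  ... | yes p  | no ¬q = Data.Empty.⊥-elim (¬q (sym p))
    where import Data.Empty
  ... | no ¬p  | yes q = Data.Empty.⊥-elim (¬p (sym q))
    where import Data.Empty

  matchAdj⊎-sym : ∀ {k} (x y : Fin k ⊎ Fin k) → matchAdj⊎ x y ≡ matchAdj⊎ y x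
  matchAdj⊎-sym (inj₁ i) (inj₁ j) = refl
  matchAdj⊎-sym (inj₁ i) (inj₂ j) = ≟-sym i j
  matchAdj⊎-sym (inj₂ i) (inj₁ j) = ≟-sym i j
  matchAdj⊎-sym (inj₂ i) (inj₂ j) = refl

  matchAdj⊎-irr : ∀ {k} (x : Fin k ⊎ Fin k) → matchAdj⊎ x x ≡ false
  matchAdj⊎-irr (inj₁ _) = refl
  matchAdj⊎-irr (inj₂ _) = refl

Matching : (k : ℕ) → Graph (k + k)
Matching k = record
  { adj        = λ i j → matchAdj⊎ (splitAt k i) (splitAt k j)
  ; adj-sym    = λ i j → matchAdj⊎-sym (splitAt k i) (splitAt k j)
  ; adj-irrefl = λ i → matchAdj⊎-irr (splitAt k i)
  }

FMFree : ∀ {f n} → Graph f → ℕ → Graph n → Set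
FMFree F s G = ¬ Contains F G × ¬ Contains (Matching (suc s)) G

allSubsets : (n : ℕ) → List (Subset n)
allSubsets zero    = [] ∷ []
allSubsets (suc n) = map (true ∷_) (allSubsets n) ++ map (false ∷_) (allSubsets n)

IsClique : ∀ {n} → Graph n → Subset n → Set
IsClique G S = ∀ i j → i ∈ S → j ∈ S → i ≢ j → Edge G i j

isClique? : ∀ {n} (G : Graph n) (S : Subset n) → Dec (IsClique G S)
isClique? G S = all? λ i → all? λ j →
  (i ∈? S) →-dec ((j ∈? S) →-dec (¬? (i ≟ j) →-dec (adj G i j ≟ᵇ true)))

NK : ∀ {n} → ℕ → Graph n → ℕ
NK k G = length (filter (λ S → (∣ S ∣ Data.Nat.≟ k) ×-dec isClique? G S) (allSubsets _))

joinAdj⊎ : ∀ {s m} → Graph s → Fin s ⊎ Fin m → Fin s ⊎ Fin m → Bool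
joinAdj⊎ D (inj₁ i) (inj₁ j) = adj D i j
joinAdj⊎ D (inj₁ _) (inj₂ _) = true
joinAdj⊎ D (inj₂ _) (inj₁ _) = true
joinAdj⊎ D (inj₂ _) (inj₂ _) = false

private
  joinAdj⊎-sym : ∀ {s m} (D : Graph s) (x y : Fin s ⊎ Fin m) → joinAdj⊎ D x y ≡ joinAdj⊎ D y x
  joinAdj⊎-sym D (inj₁ i) (inj₁ j) = adj-sym D i j
  joinAdj⊎-sym D (inj₁ _) (inj₂ _) = refl
  joinAdj⊎-sym D (inj₂ _) (inj₁ _) = refl
  joinAdj⊎-sym D (inj₂ _) (inj₂ _) = refl

  joinAdj⊎-irr : ∀ {s m} (D : Graph s) (x : Fin s ⊎ Fin m) → joinAdj⊎ D x x ≡ false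
  joinAdj⊎-irr D (inj₁ i) = adj-irrefl D i
  joinAdj⊎-irr D (inj₂ _) = refl

JoinEmpty : ∀ {s} → Graph s → (m : ℕ) → Graph (s + m)
JoinEmpty {s} D m = record
  { adj        = λ i j → joinAdj⊎ D (splitAt s i) (splitAt s j)
  ; adj-sym    = λ i j → joinAdj⊎-sym D (splitAt s i) (splitAt s j)
  ; adj-irrefl = λ i → joinAdj⊎-irr D (splitAt s i)
  }

InEXD : ∀ {f s} → Graph f → ℕ → Graph s → Set
InEXD {s = s} F k D = DFree F D × (∀ (G : Graph s) → DFree F G → NK k G ≤ NK k D)

IsDF : ∀ {f s} → Graph f → ℕ → Graph s → Set
IsDF {s = s} F r D =
  InEXD F (r ∸ 1) D × (∀ (D' : Graph s) → InEXD F (r ∸ 1) D' → NK r D' ≤ NK r D)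

IsExFM : ∀ {f} → (n r : ℕ) → Graph f → (s m : ℕ) → Set
IsExFM n r F s m =
  (Σ (Graph n) λ G → FMFree F s G × NK r G ≡ m)
  × (∀ (G : Graph n) → FMFree F s G → NK r G ≤ m)

{-# OPTIONS --safe #-}
-- Write e = N(K_{r-1}, D).  Averaging shows that a graph on t ≤ s vertices with at least e copies of
-- K_{r-1} has an (r-2)-clique Q with more than |V(F)| common neighbours, because e exceeds a large
-- multiple of s^(r-2) (compare D with a complete (r-1)-partite graph, which is D(F)-free as χ(F) > r).
-- A new vertex joined exactly to Q keeps the graph D(F)-free and creates a K_{r-1}, so a D(F)-free graph
-- on fewer than s vertices has fewer than e copies of K_{r-1}.
--
-- In an {F, M_{s+1}}-free graph G the ends of a maximal matching form a vertex cover U of bounded size, and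
-- up to O(1) the r-cliques of G are pairs of a vertex v outside U and an (r-1)-clique in N(v) ⊆ U.  If only
-- boundedly many v see e or more such cliques, G has at most (e - 1)n + O(1) copies of K_r, fewer than
-- en - O(1).  Otherwise many such v share one neighbourhood T.  Then T spans a D(F)-free graph and |T| ≤ s,
-- so |T| = s by strict monotonicity; T covers all edges (a missed edge would extend a matching of T into its
-- twins), and counting over the cover T gives the bound.
module Submission where

open import Defs
open import Data.Nat 
  using (ℕ; zero; suc; pred; _+_; _*_; _^_; _∸_; _/_; _%_; _≤_; _<_; z≤n; s≤s; _≤?_; _<?_; >-nonZero)
open import Data.Nat.Properties
open import Data.Nat.DivMod using (m≡m%n+[m/n]*n; m%n<n; /-monoˡ-≤; m*n/n≡m)
open import Data.Nat.ListAction using (sum)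
open import Data.Nat.Tactic.RingSolver using (solve-∀)
open import Data.Bool using (Bool; true; false; if_then_else_)
open import Data.Bool.Properties using () renaming (_≟_ to _≟ᵇ_)
open import Data.Fin using (Fin; zero; suc; splitAt; _↑ˡ_; _↑ʳ_; inject≤)
open import Data.Fin.Properties
  using (splitAt-↑ˡ; splitAt-↑ʳ; splitAt⁻¹-↑ˡ; splitAt⁻¹-↑ʳ; ↑ˡ-injective; ↑ʳ-injective;
         inject≤-injective; injective⇒≤; any?)
  renaming (_≟_ to _≟ᶠ_; suc-injective to Fin-suc-injective)
open import Data.Fin.Subset using (Subset; ∣_∣) renaming (_∈_ to _∈ˢ_; _∉_ to _∉ˢ_)
open import Data.Fin.Subset.Properties using () renaming (_∈?_ to _∈ˢ?_)
open import Data.Vec as Vec using ([]; _∷_; here; there)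
open import Data.Vec.Properties using (lookup∘tabulate; []=⇒lookup; lookup⇒[]=)
open import Data.List using (List; []; _∷_; _++_; map; length; filter; tabulate; allFin; lookup)
open import Data.List.Properties
  using (filter-++; filter-≐; filter-all; filter-none; filter-accept; filter-reject; length-++; length-map;
         length-filter; length-tabulate; map-tabulate; tabulate-lookup)
open import Data.List.Membership.Propositional using (_∈_; _∉_)
open import Data.List.Membership.Propositional.Properties
  using (∈-lookup; ∈-allFin; ∈-++⁺ˡ; ∈-++⁺ʳ; ∈-filter⁺; ∈-filter⁻; ∈-tabulate⁺; ∈-tabulate⁻)
open import Data.List.Membership.Propositional.Properties.WithK using (unique∧set⇒bag)
import Data.List.Membership.DecPropositional as DecMembership
open import Data.List.Relation.Binary.BagAndSetEquality using (∼bag⇒↭)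
open import Data.List.Relation.Binary.Permutation.Propositional using (_↭_; refl; prep; swap)
open import Data.List.Relation.Binary.Permutation.Propositional.Properties using (filter-↭; ++-comm; ↭-length)
open import Data.List.Relation.Binary.Sublist.Propositional using (_⊆_; []; _∷_; _∷ʳ_; ⊆-refl; ⊆-trans; minimum)
open import Data.List.Relation.Binary.Sublist.Propositional.Properties
  using (filter⁺; filter-⊆; length-mono-≤; All-resp-⊆; map⁺)
open import Data.List.Relation.Unary.Any as Any using (here; there)
open import Data.List.Relation.Unary.Any.Properties using (lookup-index)
open import Data.List.Relation.Unary.All as All using (All; []; _∷_)
import Data.List.Relation.Unary.All.Properties as All
open import Data.List.Relation.Unary.AllPairs using (AllPairs; []; _∷_)
import Data.List.Relation.Unary.AllPairs.Properties as AllPairs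
open import Data.List.Relation.Unary.Unique.Propositional using (Unique)
import Data.List.Relation.Unary.Unique.Propositional.Properties as Unique
open import Data.Product using (Σ; ∃; ∃₂; _×_; _,_; proj₁; proj₂)
open import Data.Sum using (_⊎_; inj₁; inj₂; [_,_]′)
open import Data.Unit using (⊤; tt)
open import Function using (_∘_; id; _⇔_; mk⇔; Equivalence)
open import Function.Definitions using (Injective)
open import Relation.Nullary using (¬_; Dec; yes; no; does; contradiction; ¬?; _×-dec_)
open import Relation.Nullary.Decidable using (dec-true; decidable-stable; isYes≗does)
open import Relation.Unary using (Decidable)
open import Relation.Binary.PropositionalEquality
  using (_≡_; _≢_; refl; sym; trans; cong; cong₂; subst; subst₂; module ≡-Reasoning)

variable
  V W : Set
  f k m n s : ℕ

-- Cliques in lists of vertices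

nbhd : (V → V → Bool) → V → List V → List V
nbhd a v = filter (λ w → a v w ≟ᵇ true)

-- Each clique is counted once, at its earliest vertex in the list. Unlike the filter over all
-- subsets in `NK`, this recursion exposes neighbourhoods, on which the averaging and the counts
-- over independent sets rest.
cliques : (V → V → Bool) → ℕ → List V → ℕ
cliques a zero    L       = 1
cliques a (suc k) []      = 0
cliques a (suc k) (v ∷ L) = cliques a (suc k) L + cliques a k (nbhd a v L)

filter-map : (f : V → W) {P : W → Set} {Q : V → Set} (P? : Decidable P) (Q? : Decidable Q) →
  (∀ x → does (P? (f x)) ≡ does (Q? x)) →
  ∀ xs → filter P? (map f xs) ≡ map f (filter Q? xs)
filter-map f P? Q? eq [] = refl
filter-map f P? Q? eq (x ∷ xs) with does (P? (f x)) | does (Q? x) | eq x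
... | true  | .true  | refl = cong (f x ∷_) (filter-map f P? Q? eq xs)
... | false | .false | refl = filter-map f P? Q? eq xs

filter-filter : {P Q : V → Set} (P? : Decidable P) (Q? : Decidable Q) → ∀ xs →
  filter P? (filter Q? xs) ≡ filter (λ x → Q? x ×-dec P? x) xs
filter-filter P? Q? [] = refl
filter-filter P? Q? (x ∷ xs) with does (Q? x)
... | false = filter-filter P? Q? xs
... | true with does (P? x)
... | true  = cong (x ∷_) (filter-filter P? Q? xs)
... | false = filter-filter P? Q? xs

-- The predicate `q` accumulates adjacency to the vertices already chosen, so that choosing one more
-- leaves a problem of the same form.
CliqueIn : (Fin n → V) → (V → V → Bool) → ℕ → (V → Set) → Subset n → Set
CliqueIn h a k q S =
  ∣ S ∣ ≡ k
  × (∀ i j → i ∈ˢ S → j ∈ˢ S → i ≢ j → a (h i) (h j) ≡ true)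
  × (∀ i → i ∈ˢ S → q (h i))

-- P is only equivalent to CliqueIn, so that the induction on n can pass to P ∘ (b ∷_).
count-cliques : (a : V → V → Bool) → (∀ x y → a x y ≡ a y x) →
  ∀ n k (h : Fin n → V) {q : V → Set} (q? : Decidable q)
  {P : Subset n → Set} (P? : Decidable P) → (∀ S → P S ⇔ CliqueIn h a k q S) →
  length (filter P? (allSubsets n)) ≡ cliques a k (filter q? (tabulate h))
count-cliques a a-sym zero zero h q? P? P⇔ with P? []
... | yes _ = refl
... | no ¬p with () ← ¬p (Equivalence.from (P⇔ []) (refl , (λ ()) , λ ()))
count-cliques a a-sym zero (suc k) h q? P? P⇔ with P? []
... | no _ = refl
... | yes p with () ← proj₁ (Equivalence.to (P⇔ []) p)
count-cliques a a-sym (suc n) k h {q} q? {P} P? P⇔ = begin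
  length (filter P? (map (true ∷_) A ++ map (false ∷_) A))
    ≡⟨ cong length (filter-++ P? (map (true ∷_) A) _) ⟩
  length (filter P? (map (true ∷_) A) ++ filter P? (map (false ∷_) A))
    ≡⟨ length-++ (filter P? (map (true ∷_) A)) ⟩
  length (filter P? (map (true ∷_) A)) + length (filter P? (map (false ∷_) A))
    ≡⟨ cong₂ _+_ (branch true) (branch false) ⟩
  length (filter (P? ∘ (true ∷_)) A) + length (filter (P? ∘ (false ∷_)) A)
    ≡⟨ +-comm (length (filter (P? ∘ (true ∷_)) A)) _ ⟩
  length (filter (P? ∘ (false ∷_)) A) + length (filter (P? ∘ (true ∷_)) A)
    ≡⟨ cong (_+ length (filter (P? ∘ (true ∷_)) A)) (count-cliques a a-sym n k (h ∘ suc) q? _ without) ⟩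
  cliques a k L + length (filter (P? ∘ (true ∷_)) A)
    ≡⟨ rest k P⇔ ⟩
  cliques a k (filter q? (h zero ∷ tabulate (h ∘ suc))) ∎
  where
  open ≡-Reasoning
  A = allSubsets n
  L = filter q? (tabulate (h ∘ suc))

  branch : ∀ b → length (filter P? (map (b ∷_) A)) ≡ length (filter (P? ∘ (b ∷_)) A)
  branch b = trans (cong length (filter-map (b ∷_) P? (P? ∘ (b ∷_)) (λ _ → refl) A))
    (length-map (b ∷_) (filter (P? ∘ (b ∷_)) A))

  without : ∀ S → P (false ∷ S) ⇔ CliqueIn (h ∘ suc) a k q S
  without S = mk⇔
    (λ p → let c , e , z = Equivalence.to (P⇔ (false ∷ S)) p in
      c , (λ i j i∈ j∈ i≢j → e (suc i) (suc j) (there i∈) (there j∈) (i≢j ∘ Fin-suc-injective))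
        , (λ i → z (suc i) ∘ there))
    (λ (c , e , z) → Equivalence.from (P⇔ (false ∷ S))
      ( c
      , (λ { (suc i) (suc j) (there i∈) (there j∈) i≢j → e i j i∈ j∈ (i≢j ∘ cong suc) })
      , (λ { (suc i) (there i∈) → z i i∈ })))

  with₀ : ∀ k → (∀ S → P S ⇔ CliqueIn h a (suc k) q S) → q (h zero) →
    ∀ S → P (true ∷ S) ⇔ CliqueIn (h ∘ suc) a k (λ w → q w × a (h zero) w ≡ true) S
  with₀ k P⇔ q₀ S = mk⇔
    (λ p → let c , e , z = Equivalence.to (P⇔ (true ∷ S)) p in
      suc-injective c , (λ i j i∈ j∈ i≢j → e (suc i) (suc j) (there i∈) (there j∈) (i≢j ∘ Fin-suc-injective))
      , (λ i i∈ → z (suc i) (there i∈) , e zero (suc i) here (there i∈) λ ()))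
    (λ (c , e , z) → Equivalence.from (P⇔ (true ∷ S))
      ( cong suc c
      , (λ { (suc i) (suc j) (there i∈) (there j∈) i≢j → e i j i∈ j∈ (i≢j ∘ cong suc)
           ; zero (suc j) _ (there j∈) _ → proj₂ (z j j∈)
           ; (suc i) zero (there i∈) _ _ → trans (a-sym _ _) (proj₂ (z i i∈))
           ; zero zero _ _ 0≢0 → contradiction refl 0≢0 })
      , (λ { (suc i) (there i∈) → proj₁ (z i i∈) ; zero _ → q₀ })))

  rest : ∀ k → (∀ S → P S ⇔ CliqueIn h a k q S) →
    cliques a k L + length (filter (P? ∘ (true ∷_)) A)
      ≡ cliques a k (filter q? (h zero ∷ tabulate (h ∘ suc)))
  rest zero P⇔ = cong (suc ∘ length)
    (filter-none (P? ∘ (true ∷_)) {A} (All.universal (λ S p → 1+n≢0 (proj₁ (Equivalence.to (P⇔ (true ∷ S)) p))) A))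
  rest (suc k) P⇔ with q? (h zero)
  ... | yes q₀ = cong (cliques a (suc k) L +_)
    (trans (count-cliques a a-sym n k (h ∘ suc) (λ w → q? w ×-dec (a (h zero) w ≟ᵇ true)) _ (with₀ k P⇔ q₀))
      (cong (cliques a k) (sym (filter-filter (λ w → a (h zero) w ≟ᵇ true) q? (tabulate (h ∘ suc))))))
  ... | no ¬q₀ = trans (cong (λ z → cliques a (suc k) L + length z)
    (filter-none (P? ∘ (true ∷_)) {A} (All.universal
      (λ S p → ¬q₀ (proj₂ (proj₂ (Equivalence.to (P⇔ (true ∷ S)) p)) zero here)) A))) (+-identityʳ _)

NK≡cliques : ∀ k (G : Graph n) → NK k G ≡ cliques (adj G) k (allFin n)
NK≡cliques {n} k G = trans
  (count-cliques (adj G) (adj-sym G) n k id {q = λ _ → ⊤} (λ _ → yes tt) _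
    (λ S → mk⇔ (λ (c , e) → c , e , λ _ _ → tt) (λ (c , e , _) → c , e)))
  (cong (cliques (adj G) k) (filter-all (λ _ → yes tt) (All.universal (λ _ → tt) (allFin n))))

cliques-map : (a : V → V → Bool) (b : W → W → Bool) (h : V → W) →
  (∀ x y → b (h x) (h y) ≡ a x y) → ∀ k L → cliques b k (map h L) ≡ cliques a k L
cliques-map a b h eq zero    L       = refl
cliques-map a b h eq (suc k) []      = refl
cliques-map a b h eq (suc k) (v ∷ L) = cong₂ _+_ (cliques-map a b h eq (suc k) L)
  (trans (cong (cliques b k) (filter-map h _ _ (λ x → cong (λ z → does (z ≟ᵇ true)) (eq v x)) L))
         (cliques-map a b h eq k (nbhd a v L)))

module _ (a : V → V → Bool) where

  nbhd-comm : ∀ x y L → nbhd a x (nbhd a y L) ≡ nbhd a y (nbhd a x L)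
  nbhd-comm x y L = trans (filter-filter _ _ L)
    (trans (filter-≐ _ _ ((λ (p , q) → q , p) , (λ (p , q) → q , p)) L) (sym (filter-filter _ _ L)))

  cliques-⊆ : ∀ k {L M} → L ⊆ M → cliques a k L ≤ cliques a k M
  cliques-⊆ zero    p          = ≤-refl
  cliques-⊆ (suc k) []         = ≤-refl
  cliques-⊆ (suc k) (y ∷ʳ p)   = ≤-trans (cliques-⊆ (suc k) p) (m≤m+n _ _)
  cliques-⊆ (suc k) (refl ∷ p) = +-mono-≤ (cliques-⊆ (suc k) p) (cliques-⊆ k (filter⁺ _ _ (λ { refl z → z }) p))

  cliques≤2^ : ∀ k L → cliques a k L ≤ 2 ^ length L
  cliques≤2^ zero    L       = m^n>0 2 (length L)
  cliques≤2^ (suc k) []      = z≤n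
  cliques≤2^ (suc k) (v ∷ L) = +-mono-≤ (cliques≤2^ (suc k) L)
    (≤-trans (cliques≤2^ k _) (≤-trans (^-monoʳ-≤ 2 (length-filter _ L)) (m≤m+n _ 0)))

  cliques-1 : ∀ L → cliques a 1 L ≡ length L
  cliques-1 []      = refl
  cliques-1 (v ∷ L) = trans (cong (_+ 1) (cliques-1 L)) (+-comm _ 1)

  clique-counted : ∀ {Q} → AllPairs (λ x y → a x y ≡ true) Q → 1 ≤ cliques a (length Q) Q
  clique-counted []       = ≤-refl
  clique-counted {q ∷ Q} (qs ∷ ps) = ≤-trans (clique-counted ps)
    (≤-trans (≤-reflexive (cong (cliques a (length Q)) (sym (filter-all _ qs)))) (m≤n+m _ _))

  -- A clique has at most one vertex in the independent list `R`. The sum sorts the cliques that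
  -- have one by that vertex, whose neighbours all lie in `T`.
  cliques-++-independent : ∀ k R T → AllPairs (λ x y → a x y ≡ false) R →
    cliques a (suc k) (R ++ T) ≡ cliques a (suc k) T + sum (map (λ v → cliques a k (nbhd a v T)) R)
  cliques-++-independent k []      T []       = sym (+-identityʳ _)
  cliques-++-independent k (v ∷ R) T (vs ∷ ps) = begin
    cliques a (suc k) (R ++ T) + cliques a k (nbhd a v (R ++ T))
      ≡⟨ cong (λ z → cliques a (suc k) (R ++ T) + cliques a k z)
           (trans (filter-++ _ R T) (cong (_++ nbhd a v T) none)) ⟩
    cliques a (suc k) (R ++ T) + d
      ≡⟨ cong (_+ d) (cliques-++-independent k R T ps) ⟩
    cliques a (suc k) T + D + d
      ≡⟨ +-assoc (cliques a (suc k) T) D d ⟩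
    cliques a (suc k) T + (D + d)
      ≡⟨ cong (cliques a (suc k) T +_) (+-comm D d) ⟩
    cliques a (suc k) T + (d + D) ∎
    where
    open ≡-Reasoning
    d = cliques a k (nbhd a v T)
    D = sum (map (λ v → cliques a k (nbhd a v T)) R)
    none : nbhd a v R ≡ []
    none = filter-none _ (All.map (λ p q → contradiction (trans (sym p) q) λ ()) vs)

  -- Averaging: if every vertex were the earliest one of at most `N` cliques, there would be at most
  -- `N * length L` of them. The list `L′` of later vertices is returned so that iteration yields a
  -- sublist of `L`.
  heavy-vertex : ∀ k N L → N * length L < cliques a (suc (suc k)) L →
    ∃₂ λ v L′ → (v ∷ L′ ⊆ L) × N < cliques a (suc k) (nbhd a v L′)
  heavy-vertex k N (v ∷ L) N*<c with N <? cliques a (suc k) (nbhd a v L)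
  ... | yes N< = v , L , ⊆-refl , N<
  ... | no  N≮ = let w , L′ , p , N< = heavy-vertex k N L lt in w , L′ , v ∷ʳ p , N<
    where
    lt : N * length L < cliques a (suc (suc k)) L
    lt = +-cancelʳ-< N _ _ (begin-strict
      N * length L + N                                           ≡⟨ trans (+-comm _ N) (sym (*-suc N (length L))) ⟩
      N * suc (length L)                                         <⟨ N*<c ⟩
      cliques a (suc (suc k)) L + cliques a (suc k) (nbhd a v L) ≤⟨ +-monoʳ-≤ _ (≮⇒≥ N≮) ⟩
      cliques a (suc (suc k)) L + N                              ∎)
      where open ≤-Reasoning

  -- `Q` and `C` are sublists because these inherit the absence of repetitions from `L` and clique
  -- counts are monotone along them.
  record HeavyClique (k f : ℕ) (L : List V) : Set where
    field
      Q C     : List V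
      Q⊆L     : Q ⊆ L
      C⊆L     : C ⊆ L
      clique  : AllPairs (λ x y → a x y ≡ true) Q
      size    : length Q ≡ k
      heavy   : f < length C
      common  : All (λ q → All (λ w → a q w ≡ true) C) Q

  -- Passing to the neighbourhood of a heavy vertex lowers the clique size by one and costs one
  -- factor `length L`. After `k` rounds more than `f` vertices remain, all adjacent to every vertex
  -- picked.
  heavy-clique : ∀ k f L → f * length L ^ k < cliques a (suc k) L → HeavyClique k f L
  heavy-clique zero f L lt = record
    { Q = [] ; C = L ; Q⊆L = minimum L ; C⊆L = ⊆-refl ; clique = [] ; size = refl
    ; heavy = subst₂ _<_ (*-identityʳ f) (cliques-1 L) lt ; common = [] }
  heavy-clique (suc k) f L lt = record
    { Q = v ∷ H.Q ; C = H.C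
    ; Q⊆L = ⊆-trans (refl ∷ ⊆-trans H.Q⊆L (filter-⊆ _ L′)) v∷L′⊆L
    ; C⊆L = ⊆-trans H.C⊆L N⊆L
    ; clique = All-resp-⊆ H.Q⊆L nbrs ∷ H.clique
    ; size = cong suc H.size
    ; heavy = H.heavy
    ; common = All-resp-⊆ H.C⊆L nbrs ∷ H.common }
    where
    N = f * length L ^ k
    found = heavy-vertex k N L (subst (_< cliques a (suc (suc k)) L)
      (trans (cong (f *_) (*-comm (length L) _)) (sym (*-assoc f _ (length L)))) lt)
    v = proj₁ found
    L′ = proj₁ (proj₂ found)
    v∷L′⊆L = proj₁ (proj₂ (proj₂ found))
    N⊆L : nbhd a v L′ ⊆ L
    N⊆L = ⊆-trans (v ∷ʳ filter-⊆ _ L′) v∷L′⊆L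
    nbrs : All (λ w → a v w ≡ true) (nbhd a v L′)
    nbrs = All.all-filter _ L′
    module H = HeavyClique (heavy-clique k f (nbhd a v L′)
      (≤-<-trans (*-monoʳ-≤ f (^-monoˡ-≤ k (length-mono-≤ N⊆L))) (proj₂ (proj₂ (proj₂ found)))))

  module _ (a-sym : ∀ x y → a x y ≡ a y x) where

    private
      -- The part of cliques a (suc k) (x ∷ y ∷ L) that contains both x and y.
      edgeCliques : ℕ → V → V → List V → ℕ
      edgeCliques zero    x y L = 0
      edgeCliques (suc k) x y L = if a x y then cliques a k (nbhd a y (nbhd a x L)) else 0

      edgeCliques-sym : ∀ k x y L → edgeCliques k x y L ≡ edgeCliques k y x L
      edgeCliques-sym zero    x y L = refl
      edgeCliques-sym (suc k) x y L rewrite a-sym x y | nbhd-comm x y L = refl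

      cliques-nbhd-∷ : ∀ k x y L → cliques a k (nbhd a x (y ∷ L)) ≡ cliques a k (nbhd a x L) + edgeCliques k x y L
      cliques-nbhd-∷ zero    x y L = refl
      cliques-nbhd-∷ (suc k) x y L with a x y
      ... | true  = refl
      ... | false = sym (+-identityʳ _)

      -- Sort the cliques by which of `x` and `y` they contain: the two classes with exactly one
      -- change places, and the class with both is symmetric.
      cliques-swap : ∀ k x y L → cliques a k (x ∷ y ∷ L) ≡ cliques a k (y ∷ x ∷ L)
      cliques-swap zero    x y L = refl
      cliques-swap (suc k) x y L
        rewrite cliques-nbhd-∷ k x y L | cliques-nbhd-∷ k y x L | edgeCliques-sym k x y L =
          rearrange (cliques a (suc k) L) (cliques a k (nbhd a y L)) (cliques a k (nbhd a x L)) (edgeCliques k y x L)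
        where
        rearrange : ∀ p q r s → (p + q) + (r + s) ≡ (p + r) + (q + s)
        rearrange = solve-∀

    -- The recursion reads the list in order but the count is independent of it, so an independent
    -- set can be moved to the front.
    cliques-↭ : ∀ k {L M} → L ↭ M → cliques a k L ≡ cliques a k M
    cliques-↭ zero    p           = refl
    cliques-↭ (suc k) refl        = refl
    cliques-↭ (suc k) (prep x p)  = cong₂ _+_ (cliques-↭ (suc k) p) (cliques-↭ k (filter-↭ _ p))
    cliques-↭ (suc k) {M = _ ∷ _ ∷ M} (swap x y p) = trans
      (cong₂ _+_ (cong₂ _+_ (cliques-↭ (suc k) p) (cliques-↭ k (filter-↭ _ p)))
                 (cliques-↭ k (filter-↭ (λ w → a x w ≟ᵇ true) (prep y p))))
      (cliques-swap (suc k) x y M)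
    cliques-↭ (suc k) (_↭_.trans p q) = trans (cliques-↭ (suc k) p) (cliques-↭ (suc k) q)

sum-map-const : (g : V → ℕ) {c : ℕ} {L : List V} → All (λ v → g v ≡ c) L → sum (map g L) ≡ length L * c
sum-map-const g []       = refl
sum-map-const g (p ∷ ps) = cong₂ _+_ p (sum-map-const g ps)

tabulate-+ : ∀ s {m} (h : Fin (s + m) → V) → tabulate h ≡ tabulate (h ∘ (_↑ˡ m)) ++ tabulate (h ∘ (s ↑ʳ_))
tabulate-+ zero    h = refl
tabulate-+ (suc s) h = cong (h zero ∷_) (tabulate-+ s (h ∘ suc))

-- A clique of the join uses at most one of the `m` independent vertices, and each of these sees the
-- whole of `D`.
NK-JoinEmpty : ∀ k (D : Graph s) m → NK (suc k) (JoinEmpty D m) ≡ NK (suc k) D + m * NK k D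
NK-JoinEmpty {s} k D m = begin
  NK (suc k) J                                   ≡⟨ NK≡cliques (suc k) J ⟩
  cliques (adj J) (suc k) (allFin (s + m))       ≡⟨ cong (cliques (adj J) (suc k)) (tabulate-+ s id) ⟩
  cliques (adj J) (suc k) (T ++ R)               ≡⟨ cliques-↭ (adj J) (adj-sym J) (suc k) (++-comm T R) ⟩
  cliques (adj J) (suc k) (R ++ T)               ≡⟨ cliques-++-independent (adj J) k R T
                                                     (AllPairs.tabulate⁺ (λ {i} {j} _ → inj₂-inj₂ i j)) ⟩
  cliques (adj J) (suc k) T + sum (map (λ v → cliques (adj J) k (nbhd (adj J) v T)) R)
    ≡⟨ cong₂ _+_ (onT (suc k)) (sum-map-const _ {NK k D} (All.tabulate⁺ (λ j →
         trans (cong (cliques (adj J) k) (filter-all _ (All.tabulate⁺ (inj₂-inj₁ j)))) (onT k)))) ⟩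
  NK (suc k) D + length R * NK k D               ≡⟨ cong (λ z → NK (suc k) D + z * NK k D)
                                                     (length-tabulate {n = m} (s ↑ʳ_)) ⟩
  NK (suc k) D + m * NK k D                      ∎
  where
  open ≡-Reasoning
  J = JoinEmpty D m
  T = tabulate (_↑ˡ m)
  R = tabulate (s ↑ʳ_)
  inj₂-inj₂ : ∀ i j → adj J (s ↑ʳ i) (s ↑ʳ j) ≡ false
  inj₂-inj₂ i j rewrite splitAt-↑ʳ s m i | splitAt-↑ʳ s m j = refl
  inj₂-inj₁ : ∀ i j → adj J (s ↑ʳ i) (j ↑ˡ m) ≡ true
  inj₂-inj₁ i j rewrite splitAt-↑ʳ s m i | splitAt-↑ˡ s j m = refl
  inj₁-inj₁ : ∀ i j → adj J (i ↑ˡ m) (j ↑ˡ m) ≡ adj D i j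
  inj₁-inj₁ i j rewrite splitAt-↑ˡ s i m | splitAt-↑ˡ s j m = refl
  onT : ∀ k → cliques (adj J) k T ≡ NK k D
  onT k = trans (cong (cliques (adj J) k) (sym (map-tabulate id (_↑ˡ m))))
    (trans (cliques-map (adj D) (adj J) (_↑ˡ m) inj₁-inj₁ k (allFin s)) (sym (NK≡cliques k D)))

-- The graph D ∨ I is {F, M_{s+1}}-free

comprehension : {P : Fin f → Set} → Decidable P → Σ (Subset f) λ I → ∀ v → v ∈ˢ I ⇔ P v
comprehension {P = P} P? = I , λ v → mk⇔ (to v) (from v)
  where
  I = Vec.tabulate (does ∘ P?)
  to : ∀ v → v ∈ˢ I → P v
  to v v∈I with P? v | trans (sym (lookup∘tabulate (does ∘ P?) v)) ([]=⇒lookup v∈I)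
  ... | yes p | _ = p
  from : ∀ v → P v → v ∈ˢ I
  from v p = lookup⇒[]= v I (trans (lookup∘tabulate (does ∘ P?) v) (dec-true (P? v) p))

splitAt-injective : ∀ s {m} {i j : Fin (s + m)} → splitAt s i ≡ splitAt s j → i ≡ j
splitAt-injective s {m} {i} {j} eq with splitAt s i in ei | splitAt s j in ej | eq
... | inj₁ x | .(inj₁ x) | refl = trans (sym (splitAt⁻¹-↑ˡ ei)) (splitAt⁻¹-↑ˡ ej)
... | inj₂ x | .(inj₂ x) | refl = trans (sym (splitAt⁻¹-↑ʳ ei)) (splitAt⁻¹-↑ʳ ej)

-- The vertices of `F` that a copy sends to the edgeless side form an independent set; deleting it
-- leaves a member of the family D(F) inside `D`.
JoinEmpty-Free : (F : Graph f) (D : Graph s) → DFree F D → ∀ m → ¬ Contains F (JoinEmpty D m)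
JoinEmpty-Free {f} {s} F D D-free m (g , g-inj , g-edge) =
  D-free I independent (h , h-inj , h-edge)
  where
  Right : Fin f → Set
  Right v = ∃ λ j → splitAt s {m} (g v) ≡ inj₂ j
  right? : Decidable Right
  right? v with splitAt s (g v)
  ... | inj₁ i = no λ ()
  ... | inj₂ j = yes (j , refl)
  I = proj₁ (comprehension right?)
  module I v = Equivalence (proj₂ (comprehension right?) v)
  independent : Independent F I
  independent u v u∈ v∈ uv with I.to u u∈ | I.to v v∈
  ... | i , ei | j , ej with g-edge u v uv
  ... | e rewrite ei | ej with () ← e
  left : ∀ v → v ∉ˢ I → ∃ λ i → splitAt s (g v) ≡ inj₁ i
  left v v∉I with splitAt s (g v) in eq
  ... | inj₁ i = i , refl
  ... | inj₂ j = contradiction (I.from v (j , eq)) v∉I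
  h : Rest I → Fin s
  h (v , v∉I) = proj₁ (left v v∉I)
  h-inj : Injective _≡_ _≡_ h
  h-inj {u , u∉I} {v , v∉I} eq with g-inj (splitAt-injective s
    (trans (proj₂ (left u u∉I)) (trans (cong inj₁ eq) (sym (proj₂ (left v v∉I))))))
  ... | refl = refl
  h-edge : ∀ u v → RestEdge F I u v → Edge D (h u) (h v)
  h-edge (u , u∉I) (v , v∉I) uv = subst₂ (λ x y → joinAdj⊎ D x y ≡ true)
    (proj₂ (left u u∉I)) (proj₂ (left v v∉I)) (g-edge u v uv)

-- Separate functions for the two ends make it easy to add an edge; a map from the vertices of
-- `Matching k` would have to be re-indexed.
record MatchIn (k : ℕ) (G : Graph n) : Set where
  field
    a b    : Fin k → Fin n
    a-inj  : ∀ {i j} → a i ≡ a j → i ≡ j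
    b-inj  : ∀ {i j} → b i ≡ b j → i ≡ j
    a≢b    : ∀ i j → a i ≢ b j
    a-b    : ∀ i → Edge G (a i) (b i)

matchIn⇒contains : (G : Graph n) → MatchIn k G → Contains (Matching k) G
matchIn⇒contains {n} {k} G M =
  ends ∘ splitAt k , splitAt-injective k ∘ ends-inj _ _ , λ u v → ends-edge (splitAt k u) (splitAt k v)
  where
  open MatchIn M
  ends : Fin k ⊎ Fin k → Fin n
  ends = [ a , b ]′
  ends-inj : ∀ x y → ends x ≡ ends y → x ≡ y
  ends-inj (inj₁ i) (inj₁ j) eq = cong inj₁ (a-inj eq)
  ends-inj (inj₁ i) (inj₂ j) eq = contradiction eq (a≢b i j)
  ends-inj (inj₂ i) (inj₁ j) eq = contradiction (sym eq) (a≢b j i)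
  ends-inj (inj₂ i) (inj₂ j) eq = cong inj₂ (b-inj eq)
  ends-edge : ∀ x y → matchAdj⊎ x y ≡ true → Edge G (ends x) (ends y)
  ends-edge (inj₁ i) (inj₂ j) eq with yes refl ← i ≟ᶠ j = a-b i
  ends-edge (inj₂ i) (inj₁ j) eq with yes refl ← i ≟ᶠ j = trans (adj-sym G (b i) (a i)) (a-b i)

Matching-edge : ∀ k (i : Fin k) → Edge (Matching k) (i ↑ˡ k) (k ↑ʳ i)
Matching-edge k i rewrite splitAt-↑ˡ k i k | splitAt-↑ʳ k k i =
  trans (isYes≗does (i ≟ᶠ i)) (dec-true (i ≟ᶠ i) refl)

-- Every edge of the join has an end among the `s` vertices of `D`, so `s + 1` disjoint edges would
-- inject into `Fin s`.
JoinEmpty-MatchingFree : (D : Graph s) → ∀ m → ¬ Contains (Matching (suc s)) (JoinEmpty D m)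
JoinEmpty-MatchingFree {s} D m (g , g-inj , g-edge) = 1+n≰n (injective⇒≤ {f = h} (h-inj _ _ (meets _) (meets _)))
  where
  t = suc s
  Meets : Fin t → Set
  Meets i = Σ (Fin s) λ j → splitAt s {m} (g (i ↑ˡ t)) ≡ inj₁ j ⊎ splitAt s {m} (g (t ↑ʳ i)) ≡ inj₁ j
  meets : ∀ i → Meets i
  meets i with splitAt s (g (i ↑ˡ t)) in e₁ | splitAt s (g (t ↑ʳ i)) in e₂
             | g-edge (i ↑ˡ t) (t ↑ʳ i) (Matching-edge t i)
  ... | inj₁ j | _ | _ = j , inj₁ refl
  ... | inj₂ _ | inj₁ j | _ = j , inj₂ refl
  h : Fin t → Fin s
  h i = proj₁ (meets i)
  same : ∀ {u v j} → splitAt s (g u) ≡ inj₁ j → splitAt s (g v) ≡ inj₁ j → u ≡ v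
  same p q = g-inj (splitAt-injective s (trans p (sym q)))
  ↑ˡ≢↑ʳ : ∀ i j → ¬ i ↑ˡ t ≡ t ↑ʳ j
  ↑ˡ≢↑ʳ i j eq with () ← trans (sym (splitAt-↑ˡ t i t)) (trans (cong (splitAt t) eq) (splitAt-↑ʳ t t j))
  h-inj : ∀ i j (x : Meets i) (y : Meets j) → proj₁ x ≡ proj₁ y → i ≡ j
  h-inj i j (_ , inj₁ p) (_ , inj₁ q) refl = ↑ˡ-injective t i j (same p q)
  h-inj i j (_ , inj₁ p) (_ , inj₂ q) refl = contradiction (same p q) (↑ˡ≢↑ʳ i j)
  h-inj i j (_ , inj₂ p) (_ , inj₁ q) refl = contradiction (same q p) (↑ˡ≢↑ʳ j i)
  h-inj i j (_ , inj₂ p) (_ , inj₂ q) refl = ↑ʳ-injective t i j (same p q)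

-- Colourings and D(F)-freeness

Colourable : Graph n → ℕ → Set
Colourable {n} G k = Σ (Fin n → Fin k) (ProperColouring G k)

JoinEmpty-colourable : (D : Graph s) → Colourable D k → ∀ m → Colourable (JoinEmpty D m) (suc k)
JoinEmpty-colourable {s} D (c , proper) m = colour ∘ splitAt s , λ i j → proper′ (splitAt s i) (splitAt s j)
  where
  colour : Fin s ⊎ Fin m → Fin (suc _)
  colour (inj₁ i) = suc (c i)
  colour (inj₂ _) = zero
  proper′ : ∀ x y → joinAdj⊎ D x y ≡ true → colour x ≢ colour y
  proper′ (inj₁ i) (inj₁ j) ij = proper i j ij ∘ Fin-suc-injective
  proper′ (inj₁ _) (inj₂ _) _  = λ ()
  proper′ (inj₂ _) (inj₁ _) _  = λ ()

-- A copy of `F` minus `I` pulls back a colouring with `k` colours, and one further colour on the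
-- independent set `I` extends it to `F`.
colourable⇒DFree : (F : Graph f) → ChromaticGreaterThan F (suc k) → (G : Graph n) → Colourable G k → DFree F G
colourable⇒DFree {f} {k} F χ>k+1 G (c , proper) I independent (g , _ , g-edge) = χ>k+1 (colour , proper′)
  where
  colour : Fin f → Fin (suc k)
  colour v with v ∈ˢ? I
  ... | yes _  = zero
  ... | no v∉I = suc (c (g (v , v∉I)))
  proper′ : ProperColouring F (suc k) colour
  proper′ u v uv with u ∈ˢ? I | v ∈ˢ? I
  ... | yes u∈ | yes v∈ = contradiction uv (independent u v u∈ v∈)
  ... | yes _  | no _   = λ ()
  ... | no _   | yes _  = λ ()
  ... | no u∉  | no v∉  = proper _ _ (g-edge (u , u∉) (v , v∉) uv) ∘ Fin-suc-injective

-- Strict monotonicity of ex(s, K_{r-1}, D(F))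

infix 4 _∈?_
_∈?_ : (x : Fin n) (L : List (Fin n)) → Dec (x ∈ L)
_∈?_ = DecMembership._∈?_ _≟ᶠ_

-- The product `j * q` in the form that iterating `JoinEmpty` produces, so that `turán` needs no
-- transport.
turánSize : ℕ → ℕ → ℕ
turánSize q zero    = 0
turánSize q (suc j) = turánSize q j + q

-- The complete `j`-partite graph with parts of size `q`, joined on part by part so that the count
-- and the colouring follow from those of a join.
turán : ∀ q j → Graph (turánSize q j)
turán q zero    = record { adj = λ () ; adj-sym = λ () ; adj-irrefl = λ () }
turán q (suc j) = JoinEmpty (turán q j) q

turánSize≡ : ∀ q j → turánSize q j ≡ j * q
turánSize≡ q zero    = refl
turánSize≡ q (suc j) = trans (cong (_+ q) (turánSize≡ q j)) (+-comm (j * q) q)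

turán-colourable : ∀ q j → Colourable (turán q j) j
turán-colourable q zero    = (λ ()) , λ ()
turán-colourable q (suc j) = JoinEmpty-colourable (turán q j) (turán-colourable q j) q

NK-turán : ∀ q j → q ^ j ≤ NK j (turán q j)
NK-turán q zero    = ≤-refl
NK-turán q (suc j) = ≤-trans (*-monoʳ-≤ q (NK-turán q j))
  (≤-trans (m≤n+m _ _) (≤-reflexive (sym (NK-JoinEmpty j (turán q j) q))))

^-distribʳ-* : ∀ m n k → (m * n) ^ k ≡ m ^ k * n ^ k
^-distribʳ-* m n zero    = refl
^-distribʳ-* m n (suc k) = trans (cong (m * n *_) (^-distribʳ-* m n k))
  ([m*n]*[o*p]≡[m*o]*[n*p] m n (m ^ k) (n ^ k))

-- Take a complete multipartite graph with `K = k + 1` parts of size at least `q = s / K`. One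
-- vertex from each part gives at least `q ^ K` cliques, while `s ≤ 2 * K * q` makes `s ^ k` only of
-- order `q ^ k`.
clique-rich-colourable : ∀ k f → Σ ℕ λ s₀ → ∀ s → s₀ ≤ s →
  Σ (Graph s) λ E → Colourable E (suc k) × f * s ^ k < NK (suc k) E
clique-rich-colourable k f = c * K , rich
  where
  K = suc k
  -- With this value `c ≤ q` says `f * (K + K) ^ k < q`, which is what comparing `q ^ k` with
  -- `q * q ^ k` requires.
  c = suc (f * (K + K) ^ k)
  rich : ∀ s → c * K ≤ s → Σ (Graph s) λ E → Colourable E K × f * s ^ k < NK K E
  rich s s₀≤s = subst (λ s → Σ (Graph s) λ E → Colourable E K × f * s ^ k < NK K E) size
    (E , JoinEmpty-colourable (turán q k) (turán-colourable q k) (q + s % K) , many)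
    where
    q = s / K
    -- The last part absorbs the remainder, so that there are exactly `s` vertices.
    E = JoinEmpty (turán q k) (q + s % K)
    c≤q : c ≤ q
    c≤q = ≤-trans (≤-reflexive (sym (m*n/n≡m c K))) (/-monoˡ-≤ K s₀≤s)
    0<q : 0 < q
    0<q = ≤-trans (s≤s z≤n) c≤q
    size : turánSize q k + (q + s % K) ≡ s
    size = begin
      turánSize q k + (q + s % K) ≡⟨ cong (_+ (q + s % K)) (turánSize≡ q k) ⟩
      k * q + (q + s % K)         ≡⟨ rearrange k q (s % K) ⟩
      s % K + q * K               ≡⟨ m≡m%n+[m/n]*n s K ⟨
      s                           ∎
      where
      open ≡-Reasoning
      rearrange : ∀ k q x → k * q + (q + x) ≡ x + q * suc k
      rearrange = solve-∀
    size≤ : turánSize q k + (q + s % K) ≤ (K + K) * q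
    size≤ = begin
      turánSize q k + (q + s % K) ≡⟨ size ⟩
      s                           ≡⟨ m≡m%n+[m/n]*n s K ⟩
      s % K + q * K               ≤⟨ +-monoˡ-≤ (q * K) (<⇒≤ (m%n<n s K)) ⟩
      K + q * K                   ≤⟨ +-monoˡ-≤ (q * K) (m≤n*m K q ⦃ >-nonZero 0<q ⦄) ⟩
      q * K + q * K               ≡⟨ rearrange K q ⟩
      (K + K) * q                 ∎
      where
      open ≤-Reasoning
      rearrange : ∀ K q → q * K + q * K ≡ (K + K) * q
      rearrange = solve-∀
    many : f * (turánSize q k + (q + s % K)) ^ k < NK K E
    many = begin-strict
      f * (turánSize q k + (q + s % K)) ^ k     ≤⟨ *-monoʳ-≤ f (^-monoˡ-≤ k size≤) ⟩
      f * ((K + K) * q) ^ k                     ≡⟨ cong (f *_) (^-distribʳ-* (K + K) q k) ⟩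
      f * ((K + K) ^ k * q ^ k)                 ≡⟨ *-assoc f _ _ ⟨
      f * (K + K) ^ k * q ^ k                   <⟨ *-monoˡ-< (q ^ k) ⦃ m^n≢0 q k ⦃ >-nonZero 0<q ⦄ ⦄ c≤q ⟩
      q * q ^ k                                 ≤⟨ *-mono-≤ (m≤m+n q (s % K)) (NK-turán q k) ⟩
      (q + s % K) * NK k (turán q k)            ≤⟨ m≤n+m _ _ ⟩
      NK K (turán q k) + (q + s % K) * NK k (turán q k) ≡⟨ NK-JoinEmpty k (turán q k) (q + s % K) ⟨
      NK K E                                    ∎
      where open ≤-Reasoning

-- Attaching a vertex to a clique

lookup-injective : {xs : List V} → Unique xs → ∀ i j → lookup xs i ≡ lookup xs j → i ≡ j
lookup-injective (_ ∷ _)  zero    zero    _  = refl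
lookup-injective (x∉ ∷ _) zero    (suc j) eq = contradiction eq (All.lookup x∉ (∈-lookup j))
lookup-injective (x∉ ∷ _) (suc i) zero    eq = contradiction (sym eq) (All.lookup x∉ (∈-lookup i))
lookup-injective (_ ∷ u)  (suc i) (suc j) eq = cong suc (lookup-injective u i j eq)

-- Pigeonhole: each `v` is related to at most one `w`, so if every element of `C` were related to
-- some `v`, choosing one for each would inject `C` into `Fin n`.
unhit : {R : V → Fin n → Set} → (∀ w v → Dec (R w v)) → (∀ {w w′ v} → R w v → R w′ v → w ≡ w′) →
  {C : List V} → Unique C → n < length C → ∃ λ w → w ∈ C × ∀ v → ¬ R w v
unhit {n = n} {R} R? functional {C} unique n<C with any? (λ i → ¬? (any? (R? (lookup C i))))
... | yes (i , ¬hit) = lookup C i , ∈-lookup i , λ v r → ¬hit (v , r)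
... | no  ¬unhit     = contradiction (injective⇒≤ {f = proj₁ ∘ hit} inj) (<⇒≱ n<C)
  where
  hit : ∀ i → ∃ (R (lookup C i))
  hit i = decidable-stable (any? (R? (lookup C i))) (λ ¬h → ¬unhit (i , ¬h))
  inj : Injective _≡_ _≡_ (proj₁ ∘ hit)
  inj {i} {j} eq = lookup-injective unique i j
    (functional (proj₂ (hit i)) (subst (R (lookup C j)) (sym eq) (proj₂ (hit j))))

attach : Graph n → List (Fin n) → Graph (suc n)
attach {n} H Q = record { adj = A ; adj-sym = A-sym ; adj-irrefl = A-irrefl }
  where
  A : Fin (suc n) → Fin (suc n) → Bool
  A zero    zero    = false
  A zero    (suc j) = does (j ∈? Q)
  A (suc i) zero    = does (i ∈? Q)
  A (suc i) (suc j) = adj H i j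
  A-sym : ∀ i j → A i j ≡ A j i
  A-sym zero    zero    = refl
  A-sym zero    (suc j) = refl
  A-sym (suc i) zero    = refl
  A-sym (suc i) (suc j) = adj-sym H i j
  A-irrefl : ∀ i → A i i ≡ false
  A-irrefl zero    = refl
  A-irrefl (suc i) = adj-irrefl H i

-- The new vertex comes first in the list, so the recursion separates the old cliques from those
-- through it, and `Q` supplies one of the latter.
NK-attach : (H : Graph n) {Q : List (Fin n)} → Q ⊆ allFin n → AllPairs (Edge H) Q → length Q ≡ k →
  NK (suc k) H < NK (suc k) (attach H Q)
NK-attach {n} {k} H {Q} Q⊆ clique refl = begin-strict
  NK (suc k) H                                  ≡⟨ NK≡cliques (suc k) H ⟩
  cliques (adj H) (suc k) (allFin n)            ≡⟨ cliques-map (adj H) A suc (λ _ _ → refl) (suc k) (allFin n) ⟨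
  cliques A (suc k) (map suc (allFin n))        ≡⟨ cong (cliques A (suc k)) (map-tabulate id suc) ⟩
  cliques A (suc k) (tabulate suc)              <⟨ m<m+n _ new ⟩
  cliques A (suc k) (allFin (suc n))            ≡⟨ NK≡cliques (suc k) (attach H Q) ⟨
  NK (suc k) (attach H Q)                       ∎
  where
  open ≤-Reasoning
  A = adj (attach H Q)
  new : 1 ≤ cliques A k (nbhd A zero (tabulate suc))
  new = begin
    1                                             ≤⟨ clique-counted A (AllPairs.map⁺ clique) ⟩
    cliques A (length (map suc Q)) (map suc Q)    ≡⟨ cong (λ z → cliques A z (map suc Q)) (length-map suc Q) ⟩
    cliques A k (map suc Q)                       ≡⟨ cong (cliques A k) (filter-all _ (All.map⁺
                                                       (All.tabulate (λ {x} x∈Q → dec-true (x ∈? Q) x∈Q)))) ⟨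
    cliques A k (nbhd A zero (map suc Q))         ≤⟨ cliques-⊆ A k (filter⁺ _ _ (λ { refl z → z })
                                                       (subst (map suc Q ⊆_) (map-tabulate id suc) (map⁺ suc Q⊆))) ⟩
    cliques A k (nbhd A zero (tabulate suc))      ∎

-- The new vertex of a copy in `attach H Q` can be moved to an unused common neighbour of Q.
attach-DFree : (F : Graph f) (H : Graph n) → DFree F H → {Q C : List (Fin n)} →
  All (λ q → All (Edge H q) C) Q → Unique C → f < length C → DFree F (attach H Q)
attach-DFree {f} {n} F H H-free {Q} {C} common unique f<C I independent (g , g-inj , g-edge) =
  H-free I independent (move ∘ g , (λ {x} {y} eq → g-inj (move-inj (g x) (g y) (avoids x) (avoids y) eq))
    , λ x y xy → move-edge (g x) (g y) (g-edge x y xy))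
  where
  Hits : Fin n → Fin f → Set
  Hits w v = Σ (v ∉ˢ I) λ v∉I → g (v , v∉I) ≡ suc w
  hits? : ∀ w v → Dec (Hits w v)
  hits? w v with v ∈ˢ? I
  ... | yes v∈I = no λ (v∉I , _) → v∉I v∈I
  ... | no  v∉I with g (v , v∉I) ≟ᶠ suc w
  ...   | yes eq = yes (v∉I , eq)
  ...   | no  ne = no λ (_ , eq) → ne eq
  -- The copy has at most `f` vertices and `C` has more than `f`, so some common neighbour lies
  -- outside the copy.
  free = unhit hits? (λ (_ , p) (_ , q) → Fin-suc-injective (trans (sym p) q)) unique f<C
  w = proj₁ free
  avoids : ∀ x → g x ≢ suc w
  avoids (v , v∉I) eq = proj₂ (proj₂ free) v (v∉I , eq)
  move : Fin (suc n) → Fin n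
  move zero    = w
  move (suc y) = y
  move-inj : ∀ x y → x ≢ suc w → y ≢ suc w → move x ≡ move y → x ≡ y
  move-inj zero    zero    _  _  _    = refl
  move-inj zero    (suc y) _  ny refl = contradiction refl ny
  move-inj (suc x) zero    nx _  refl = contradiction refl nx
  move-inj (suc x) (suc y) _  _  refl = refl
  ∈Q⇒Edge : ∀ y → does (y ∈? Q) ≡ true → Edge H y w
  ∈Q⇒Edge y d with yes y∈Q ← y ∈? Q = All.lookup (All.lookup common y∈Q) (proj₁ (proj₂ free))
  move-edge : ∀ x y → Edge (attach H Q) x y → Edge H (move x) (move y)
  move-edge zero    (suc y) e = trans (adj-sym H w y) (∈Q⇒Edge y e)
  move-edge (suc x) zero    e = ∈Q⇒Edge x e
  move-edge (suc x) (suc y) e = e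

AllPairs-⊆ : {R : V → V → Set} {L M : List V} → L ⊆ M → AllPairs R M → AllPairs R L
AllPairs-⊆ []         []       = []
AllPairs-⊆ (_ ∷ʳ p)   (_ ∷ u)  = AllPairs-⊆ p u
AllPairs-⊆ (refl ∷ p) (x ∷ u)  = All-resp-⊆ p x ∷ AllPairs-⊆ p u

module _ (F : Graph f) (k s : ℕ) where

  -- The threshold is `f * s ^ k` for every `t ≤ s`, so the step can be repeated up to `s` vertices.
  grow : ∀ {t} → t ≤ s → (H : Graph t) → DFree F H → f * s ^ k < NK (suc k) H →
    Σ (Graph (suc t)) λ H′ → DFree F H′ × NK (suc k) H < NK (suc k) H′
  grow {t} t≤s H H-free many =
    attach H Q , attach-DFree F H H-free common (AllPairs-⊆ C⊆L (Unique.allFin⁺ t)) heavy ,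
    NK-attach H Q⊆L clique size
    where
    many′ : f * length (allFin t) ^ k < cliques (adj H) (suc k) (allFin t)
    many′ = begin-strict
      f * length (allFin t) ^ k          ≡⟨ cong (λ z → f * z ^ k) (length-tabulate {n = t} id) ⟩
      f * t ^ k                          ≤⟨ *-monoʳ-≤ f (^-monoˡ-≤ k t≤s) ⟩
      f * s ^ k                          <⟨ many ⟩
      NK (suc k) H                       ≡⟨ NK≡cliques (suc k) H ⟩
      cliques (adj H) (suc k) (allFin t) ∎
      where open ≤-Reasoning
    open HeavyClique (heavy-clique (adj H) k f (allFin t) many′)

  module _ (e : ℕ) (rich : f * s ^ k < e) (extremal : ∀ (G : Graph s) → DFree F G → NK (suc k) G ≤ e) where

    -- Induction on the number `d` of missing vertices: a graph with more than `e` cliques grows to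
    -- one with still more, and on `s` vertices this contradicts extremality.
    NK-bound : ∀ d {t} → t + d ≡ s → (H : Graph t) → DFree F H → NK (suc k) H ≤ e
    NK-bound zero    {t} eq H H-free with refl ← trans (sym (+-identityʳ t)) eq = extremal H H-free
    NK-bound (suc d) {t} eq H H-free = ≮⇒≥ λ e<NK →
      let H′ , H′-free , NK< = grow (m+n≤o⇒m≤o t (≤-reflexive eq)) H H-free (<-trans rich e<NK)
      in <⇒≱ (<-trans e<NK NK<) (NK-bound d (trans (sym (+-suc t d)) eq) H′ H′-free)

    -- Growing a graph with `e` cliques gives more than `e` on at most `s` vertices. This strictness
    -- later rules out a common neighbourhood smaller than `s`.
    NK-bound-< : ∀ {t} → t < s → (H : Graph t) → DFree F H → NK (suc k) H < e
    NK-bound-< {t} t<s H H-free = ≰⇒> λ e≤NK →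
      let H′ , H′-free , NK< = grow (<⇒≤ t<s) H H-free (<-≤-trans rich e≤NK)
      in <⇒≱ (≤-<-trans e≤NK NK<) (NK-bound (s ∸ suc t) (m+[n∸m]≡n t<s) H′ H′-free)

-- Covers, matchings and twins

length-filter-split : {P : V → Set} (P? : Decidable P) → ∀ L →
  length L ≡ length (filter P? L) + length (filter (¬? ∘ P?) L)
length-filter-split P? [] = refl
length-filter-split P? (x ∷ L) with does (P? x)
... | true  = cong suc (length-filter-split P? L)
... | false = trans (cong suc (length-filter-split P? L)) (sym (+-suc _ _))

unique-length-≤ : {C X : List V} → (∀ (x y : V) → Dec (x ≡ y)) → Unique C →
  (∀ {w} → w ∈ C → w ∈ X) → length C ≤ length X
unique-length-≤ {C = C} {X} _≟_ unique C⊆X = ≮⇒≥ λ X<C →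
  let w , w∈C , missed = unhit {R = λ w i → lookup X i ≡ w} (λ w i → lookup X i ≟ w)
        (λ p q → trans (sym p) q) unique X<C
  in missed (Any.index (C⊆X w∈C)) (sym (lookup-index (C⊆X w∈C)))

sum-map-≤ : (g : V → ℕ) {c : ℕ} → (∀ v → g v ≤ c) → ∀ L → sum (map g L) ≤ length L * c
sum-map-≤ g g≤c []      = z≤n
sum-map-≤ g g≤c (v ∷ L) = +-mono-≤ (g≤c v) (sum-map-≤ g g≤c L)

-- Entries above `c` are charged `M`. Charging `c` to all entries, not just the small ones, avoids a
-- subtraction.
sum-map-≤-split : (g : V → ℕ) (c M : ℕ) → (∀ v → g v ≤ M) → ∀ L →
  sum (map g L) ≤ length (filter (λ v → suc c ≤? g v) L) * M + length L * c
sum-map-≤-split g c M g≤M [] = z≤n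
sum-map-≤-split g c M g≤M (v ∷ L) with suc c ≤? g v
... | yes g> = begin
  g v + sum (map g L)         ≤⟨ +-mono-≤ (g≤M v) (sum-map-≤-split g c M g≤M L) ⟩
  M + (a * M + length L * c)  ≡⟨ +-assoc M (a * M) _ ⟨
  M + a * M + length L * c    ≤⟨ +-monoʳ-≤ (M + a * M) (m≤n+m _ c) ⟩
  M + a * M + (c + length L * c)
    ≡⟨ cong (λ z → length z * M + (c + length L * c)) (filter-accept (λ v → suc c ≤? g v) g>) ⟨
  length (filter (λ v → suc c ≤? g v) (v ∷ L)) * M + (c + length L * c) ∎
  where
  open ≤-Reasoning
  a = length (filter (λ v → suc c ≤? g v) L)
... | no g≱ = begin
  g v + sum (map g L)         ≤⟨ +-mono-≤ (≤-pred (≰⇒> g≱)) (sum-map-≤-split g c M g≤M L) ⟩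
  c + (a * M + length L * c)  ≡⟨ rearrange c (a * M) (length L * c) ⟩
  a * M + (c + length L * c)
    ≡⟨ cong (λ z → length z * M + (c + length L * c)) (filter-reject (λ v → suc c ≤? g v) g≱) ⟨
  length (filter (λ v → suc c ≤? g v) (v ∷ L)) * M + (c + length L * c) ∎
  where
  open ≤-Reasoning
  a = length (filter (λ v → suc c ≤? g v) L)
  rearrange : ∀ x y z → x + (y + z) ≡ y + (x + z)
  rearrange = solve-∀

record Twins (a : V → V → Bool) (U A : List V) (B : ℕ) : Set where
  field
    T A′  : List V
    T⊆U   : T ⊆ U
    A′⊆A  : A′ ⊆ A
    many  : B < length A′
    nbrs  : All (λ v → nbhd a v U ≡ T) A′

-- Pigeonhole over the `2 ^ length U` possible neighbourhoods, one vertex `u` at a time: either the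
-- neighbours or the non-neighbours of `u` exceed half of the bound.
twins : (a : V → V → Bool) (B : ℕ) → ∀ U A → B * 2 ^ length U < length A → Twins a U A B
twins a B [] A lt = record
  { T = [] ; A′ = A ; T⊆U = [] ; A′⊆A = ⊆-refl ; many = subst (_< length A) (*-identityʳ B) lt
  ; nbrs = All.universal (λ _ → refl) A }
twins {V} a B (u ∷ U) A lt with B * 2 ^ length U <? length (filter (λ v → a v u ≟ᵇ true) A)
... | yes lt₁ = record
  { T = u ∷ T ; A′ = A′ ; T⊆U = refl ∷ T⊆U ; A′⊆A = ⊆-trans A′⊆A (filter-⊆ _ A) ; many = many
  ; nbrs = All.zipWith (λ {v} (p , q) → trans (filter-accept (λ w → a v w ≟ᵇ true) q) (cong (u ∷_) p))
      (nbrs , All-resp-⊆ A′⊆A (All.all-filter _ A)) }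
  where open Twins (twins a B U (filter (λ v → a v u ≟ᵇ true) A) lt₁)
... | no ≮₁ = record
  { T = T ; A′ = A′ ; T⊆U = u ∷ʳ T⊆U ; A′⊆A = ⊆-trans A′⊆A (filter-⊆ _ A) ; many = many
  ; nbrs = All.zipWith (λ {v} (p , q) → trans (filter-reject (λ w → a v w ≟ᵇ true) q) p)
      (nbrs , All-resp-⊆ A′⊆A (All.all-filter _ A)) }
  where
  N? : Decidable (λ v → a v u ≡ true)
  N? v = a v u ≟ᵇ true
  lt₀ : B * 2 ^ length U < length (filter (¬? ∘ N?) A)
  lt₀ = +-cancelˡ-< (B * 2 ^ length U) _ _ (begin-strict
    B * 2 ^ length U + B * 2 ^ length U                     ≡⟨ rearrange B (2 ^ length U) ⟩
    B * 2 ^ suc (length U)                                  <⟨ lt ⟩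
    length A                                                ≡⟨ length-filter-split N? A ⟩
    length (filter N? A) + length (filter (¬? ∘ N?) A)      ≤⟨ +-monoˡ-≤ _ (≮⇒≥ ≮₁) ⟩
    B * 2 ^ length U + length (filter (¬? ∘ N?) A)          ∎)
    where
    open ≤-Reasoning
    rearrange : ∀ B x → B * x + B * x ≡ B * (x + (x + 0))
    rearrange = solve-∀
  open Twins (twins a B U (filter (¬? ∘ N?) A) lt₀)

induced : Graph n → (T : List (Fin n)) → Graph (length T)
induced G T = record
  { adj        = λ i j → adj G (lookup T i) (lookup T j)
  ; adj-sym    = λ i j → adj-sym G (lookup T i) (lookup T j)
  ; adj-irrefl = λ i → adj-irrefl G (lookup T i)
  }

NK-induced : ∀ k (G : Graph n) T → NK k (induced G T) ≡ cliques (adj G) k T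
NK-induced k G T = begin
  NK k (induced G T)                                      ≡⟨ NK≡cliques k (induced G T) ⟩
  cliques (adj (induced G T)) k (allFin (length T))       ≡⟨ cliques-map _ (adj G) (lookup T) (λ _ _ → refl) k _ ⟨
  cliques (adj G) k (map (lookup T) (allFin (length T)))  ≡⟨ cong (cliques (adj G) k)
                                                               (trans (map-tabulate id (lookup T)) (tabulate-lookup T)) ⟩
  cliques (adj G) k T                                     ∎
  where open ≡-Reasoning

-- With at least as many copies as `D`, the graph `H` is itself extremal, so it competes in the
-- second maximisation that defines `D`. The equation `t ≡ s` allows `t` to be the length of a list.
InEXD-bounds : ∀ {t} (F : Graph f) k (D : Graph s) → IsDF F (suc k) D →
  t ≡ s → (H : Graph t) → DFree F H → NK k D ≤ NK k H →
  NK (suc k) H ≤ NK (suc k) D × NK k H ≤ NK k D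
InEXD-bounds F k D ((_ , D-max) , D-maxʳ) refl H H-free D≤H =
  D-maxʳ H (H-free , λ G G-free → ≤-trans (D-max G G-free) D≤H) , D-max H H-free

module _ (G : Graph n) where

  Cover : List (Fin n) → Set
  Cover U = ∀ x y → Edge G x y → x ∈ U ⊎ y ∈ U

  Outside : List (Fin n) → List (Fin n)
  Outside U = filter (λ v → ¬? (v ∈? U)) (allFin n)

  Outside-∉ : ∀ U → All (_∉ U) (Outside U)
  Outside-∉ U = All.all-filter _ (allFin n)

  Edge⇒≢ : ∀ {x y} → Edge G x y → x ≢ y
  Edge⇒≢ {x} e refl with () ← trans (sym (adj-irrefl G x)) e

  Outside-↭ : ∀ {U} → Unique U → allFin n ↭ Outside U ++ U
  Outside-↭ {U} unique = ∼bag⇒↭ (unique∧set⇒bag (Unique.allFin⁺ n)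
    (Unique.++⁺ (Unique.filter⁺ _ (Unique.allFin⁺ n)) unique
      (λ (p , q) → All.lookup (Outside-∉ U) p q))
    (λ {w} → mk⇔ (λ _ → everywhere w) (λ _ → ∈-allFin w)))
    where
    everywhere : ∀ w → w ∈ Outside U ++ U
    everywhere w with w ∈? U
    ... | yes w∈U = ∈-++⁺ʳ (Outside U) w∈U
    ... | no  w∉U = ∈-++⁺ˡ (∈-filter⁺ _ (∈-allFin w) w∉U)

  length-Outside : ∀ {U} → Unique U → length (Outside U) + length U ≡ n
  length-Outside {U} unique = trans (sym (length-++ (Outside U)))
    (trans (sym (↭-length (Outside-↭ unique))) (length-tabulate id))

  -- The complement of a vertex cover is independent, so each clique has at most one vertex outside
  -- `U`.
  NK-cover : ∀ k {U} → Unique U → Cover U →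
    NK (suc k) G ≡ cliques (adj G) (suc k) U + sum (map (λ v → cliques (adj G) k (nbhd (adj G) v U)) (Outside U))
  NK-cover k {U} unique cover = trans (NK≡cliques (suc k) G)
    (trans (cliques-↭ (adj G) (adj-sym G) (suc k) (Outside-↭ unique))
      (cliques-++-independent (adj G) k (Outside U) U (independent (Outside-∉ U))))
    where
    nonadj : ∀ {x y} → x ∉ U → y ∉ U → adj G x y ≡ false
    nonadj {x} {y} x∉ y∉ with adj G x y in e
    ... | false = refl
    ... | true  = contradiction (cover x y e) [ x∉ , y∉ ]′
    independent : ∀ {R} → All (_∉ U) R → AllPairs (λ x y → adj G x y ≡ false) R
    independent []       = []
    independent (p ∷ ps) = All.map (nonadj p) ps ∷ independent ps

  addEdge : (M : MatchIn k G) → ∀ {x y} → Edge G x y →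
    (∀ i → x ≢ MatchIn.a M i × x ≢ MatchIn.b M i) → (∀ i → y ≢ MatchIn.a M i × y ≢ MatchIn.b M i) →
    MatchIn (suc k) G
  addEdge {k} M {x} {y} xy x∉ y∉ = record
    { a = a′ ; b = b′ ; a-inj = a′-inj _ _ ; b-inj = b′-inj _ _ ; a≢b = a′≢b′ ; a-b = a′-b′ }
    where
    open MatchIn M
    a′ b′ : Fin (suc k) → Fin n
    a′ zero    = x
    a′ (suc i) = a i
    b′ zero    = y
    b′ (suc i) = b i
    a′-inj : ∀ i j → a′ i ≡ a′ j → i ≡ j
    a′-inj zero    zero    _ = refl
    a′-inj zero    (suc j) e = contradiction e (proj₁ (x∉ j))
    a′-inj (suc i) zero    e = contradiction (sym e) (proj₁ (x∉ i))
    a′-inj (suc i) (suc j) e = cong suc (a-inj e)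
    b′-inj : ∀ i j → b′ i ≡ b′ j → i ≡ j
    b′-inj zero    zero    _ = refl
    b′-inj zero    (suc j) e = contradiction e (proj₂ (y∉ j))
    b′-inj (suc i) zero    e = contradiction (sym e) (proj₂ (y∉ i))
    b′-inj (suc i) (suc j) e = cong suc (b-inj e)
    a′≢b′ : ∀ i j → a′ i ≢ b′ j
    a′≢b′ zero    zero    = Edge⇒≢ xy
    a′≢b′ zero    (suc j) = proj₂ (x∉ j)
    a′≢b′ (suc i) zero    = proj₁ (y∉ i) ∘ sym
    a′≢b′ (suc i) (suc j) = a≢b i j
    a′-b′ : ∀ i → Edge G (a′ i) (b′ i)
    a′-b′ zero    = xy
    a′-b′ (suc i) = a-b i

  SmallCover : ℕ → Set
  SmallCover c = Σ (List (Fin n)) λ U → length U ≤ c × Unique U × Cover U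

  -- Greedy extension: when no edge avoids the ends of the current matching, these ends form a
  -- cover.
  matching-or-cover : ∀ k → MatchIn k G ⊎ SmallCover (k + k)
  matching-or-cover zero = inj₁ (record
    { a = λ () ; b = λ () ; a-inj = λ { {()} } ; b-inj = λ { {()} } ; a≢b = λ () ; a-b = λ () })
  matching-or-cover (suc k) with matching-or-cover k
  ... | inj₂ (U , len , rest) = inj₂ (U , ≤-trans len (+-mono-≤ (n≤1+n k) (n≤1+n k)) , rest)
  ... | inj₁ M with any? (λ x → any? (λ y → (adj G x y ≟ᵇ true) ×-dec ¬? (x ∈? ends) ×-dec ¬? (y ∈? ends)))
    where
    open MatchIn M
    ends = tabulate a ++ tabulate b
  ...   | yes (x , y , xy , x∉ , y∉) = inj₁ (addEdge M xy (avoid x∉) (avoid y∉))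
    where
    open MatchIn M
    avoid : ∀ {x} → x ∉ tabulate a ++ tabulate b → ∀ i → x ≢ a i × x ≢ b i
    avoid x∉ i = (λ { refl → x∉ (∈-++⁺ˡ (∈-tabulate⁺ i)) })
              , (λ { refl → x∉ (∈-++⁺ʳ (tabulate a) (∈-tabulate⁺ i)) })
  ...   | no none = inj₂ (ends , len , unique , cover)
    where
    open MatchIn M
    ends = tabulate a ++ tabulate b
    len : length ends ≤ suc k + suc k
    len = ≤-trans (≤-reflexive (trans (length-++ (tabulate a)) (cong₂ _+_ (length-tabulate a) (length-tabulate b))))
      (+-mono-≤ (n≤1+n k) (n≤1+n k))
    unique : Unique ends
    unique = Unique.++⁺ (Unique.tabulate⁺ a-inj) (Unique.tabulate⁺ b-inj) disjoint
      where
      disjoint : ∀ {v} → ¬ (v ∈ tabulate a × v ∈ tabulate b)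
      disjoint (p , q) with i , refl ← ∈-tabulate⁻ p | j , eq ← ∈-tabulate⁻ q = a≢b i j eq
    cover : Cover ends
    cover x y xy with x ∈? ends | y ∈? ends
    ... | yes p | _     = inj₁ p
    ... | no _  | yes q = inj₂ q
    ... | no p  | no q  = contradiction (x , y , xy , p , q) none

  CompleteTo : List (Fin n) → List (Fin n) → Set
  CompleteTo A T = ∀ {v t} → v ∈ A → t ∈ T → Edge G v t

  module _ {A T : List (Fin n)} (A-unique : Unique A) (T-unique : Unique T) (complete : CompleteTo A T) where

    bipartite-matching : k ≤ length A → k ≤ length T → MatchIn k G
    bipartite-matching k≤A k≤T = record
      { a     = λ i → lookup A (inject≤ i k≤A)
      ; b     = λ i → lookup T (inject≤ i k≤T)
      ; a-inj = λ eq → inject≤-injective k≤A k≤A _ _ (lookup-injective A-unique _ _ eq)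
      ; b-inj = λ eq → inject≤-injective k≤T k≤T _ _ (lookup-injective T-unique _ _ eq)
      ; a≢b   = λ i j → Edge⇒≢ (complete (∈-lookup (inject≤ i k≤A)) (∈-lookup (inject≤ j k≤T)))
      ; a-b   = λ i → complete (∈-lookup (inject≤ i k≤A)) (∈-lookup (inject≤ i k≤T))
      }

    -- Vertices of `A` can play the deleted set `I`: they are adjacent to all of `T`, and `I` asks
    -- for no edges inside. This turns a copy of `F` minus `I` in `T` into a copy of `F`.
    complete-DFree : (F : Graph f) → ¬ Contains F G → f ≤ length A → DFree F (induced G T)
    complete-DFree {f} F F⊈G f≤A I independent (h , h-inj , h-edge) =
      F⊈G (φ , (λ {u} {v} → φ-inj u v) , φ-edge)
      where
      twin : Fin f → Fin n
      twin v = lookup A (inject≤ v f≤A)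
      φ : Fin f → Fin n
      φ v with v ∈ˢ? I
      ... | yes _  = twin v
      ... | no v∉I = lookup T (h (v , v∉I))
      twin-T : ∀ v i → Edge G (twin v) (lookup T i)
      twin-T v i = complete (∈-lookup (inject≤ v f≤A)) (∈-lookup i)
      φ-inj : ∀ u v → φ u ≡ φ v → u ≡ v
      φ-inj u v eq with u ∈ˢ? I | v ∈ˢ? I
      ... | yes _ | yes _ = inject≤-injective f≤A f≤A u v (lookup-injective A-unique _ _ eq)
      ... | yes _ | no _  = contradiction eq (Edge⇒≢ (twin-T u _))
      ... | no _  | yes _ = contradiction (sym eq) (Edge⇒≢ (twin-T v _))
      ... | no _  | no _  with refl ← h-inj (lookup-injective T-unique _ _ eq) = refl
      φ-edge : ∀ u v → Edge F u v → Edge G (φ u) (φ v)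
      φ-edge u v uv with u ∈ˢ? I | v ∈ˢ? I
      ... | yes u∈ | yes v∈ = contradiction uv (independent u v u∈ v∈)
      ... | yes _  | no _   = twin-T u _
      ... | no _   | yes _  = trans (adj-sym G _ _) (twin-T v _)
      ... | no u∉  | no v∉  = h-edge (u , u∉) (v , v∉) uv

  -- An edge `x y` missing `T`, together with a matching of `T` into `A` without `x` and `y`, has
  -- `length T + 1` edges. The 2 in the size condition pays for removing `x` and `y`.
  complete-cover : ∀ {A T} → Unique A → Unique T → CompleteTo A T → ¬ Contains (Matching (suc (length T))) G →
    2 + length T ≤ length A → Cover T
  complete-cover {A} {T} A-unique T-unique complete no-matching many x y xy with x ∈? T | y ∈? T
  ... | yes p | _     = inj₁ p
  ... | no _  | yes q = inj₂ q
  ... | no x∉ | no y∉ = contradiction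
    (matchIn⇒contains G (addEdge M xy (avoid (here refl) x∉) (avoid (there (here refl)) y∉))) no-matching
    where
    X = x ∷ y ∷ []
    A⁻ = filter (λ v → ¬? (v ∈? X)) A
    M : MatchIn (length T) G
    M = bipartite-matching (Unique.filter⁺ _ A-unique) T-unique
      (λ v∈ → complete (proj₁ (∈-filter⁻ _ v∈))) T≤A⁻ ≤-refl
      where
      T≤A⁻ : length T ≤ length A⁻
      T≤A⁻ = +-cancelˡ-≤ 2 _ _ (begin
        2 + length T                                   ≤⟨ many ⟩
        length A                                       ≡⟨ length-filter-split (_∈? X) A ⟩
        length (filter (_∈? X) A) + length A⁻          ≤⟨ +-monoˡ-≤ _ (unique-length-≤ _≟ᶠ_ (Unique.filter⁺ _ A-unique)
                                                             (λ w∈ → proj₂ (∈-filter⁻ (_∈? X) {xs = A} w∈))) ⟩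
        2 + length A⁻                                  ∎)
        where open ≤-Reasoning
    avoid : ∀ {z} → z ∈ X → z ∉ T → ∀ i → z ≢ MatchIn.a M i × z ≢ MatchIn.b M i
    avoid z∈X z∉T i =
      (λ { refl → proj₂ (∈-filter⁻ (λ v → ¬? (v ∈? X)) {xs = A} (∈-lookup {xs = A⁻} _)) z∈X })
      , (λ { refl → z∉T (∈-lookup _) })

-- The upper bound

-- The number of subsets of a cover of the maximal size `2 * (s + 1)`. It bounds both the cliques
-- inside the cover and the possible neighbourhoods in it.
coverSubsets : ℕ → ℕ
coverSubsets s = 2 ^ (suc s + suc s)

-- `f` twins complete a copy of `F`, and `s + 2` still match an `s`-set after two are removed. The
-- summands of `excess` bound the cliques inside the cover, those at the few exceptional vertices,
-- and `s * (e - 1)`.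
twinBound excess : ℕ → ℕ → ℕ
twinBound f s = f + suc (suc s)
excess f s    = coverSubsets s + twinBound f s * coverSubsets s * coverSubsets s + s * 2 ^ s

module _ (F : Graph f) (k : ℕ) (D : Graph s) (isDF : IsDF F (suc (suc k)) D)
  (rich : f * s ^ k < NK (suc k) D) (m : ℕ) (G : Graph (s + m)) (G-free : FMFree F s G) where

  private
    e = NK (suc k) D
    D-max : ∀ (H : Graph s) → DFree F H → NK (suc k) H ≤ e
    D-max = proj₂ (proj₁ isDF)
    -- The count compares with e - 1, so e = 0 (where pred truncates) has to be excluded.
    suc-pred-e : suc (pred e) ≡ e
    suc-pred-e = suc-pred e ⦃ >-nonZero (≤-<-trans z≤n rich) ⦄
    c = adj G
    no-matching : ¬ MatchIn (suc s) G
    no-matching M = proj₂ G-free (matchIn⇒contains G M)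

  twins-bound : ∀ {A T} → Unique A → Unique T → CompleteTo G A T →
    twinBound f s ≤ length A → e ≤ cliques c (suc k) T →
    NK (suc (suc k)) G ≤ NK (suc (suc k)) D + m * e
  twins-bound {A} {T} A-unique T-unique complete many e≤T = begin
    NK (suc (suc k)) G
      ≡⟨ NK-cover G (suc k) T-unique cover ⟩
    cliques c (suc (suc k)) T + sum (map (λ v → cliques c (suc k) (nbhd c v T)) (Outside G T))
      -- `T` spans an extremal graph, so the tie-break in the choice of `D` bounds the cliques
      -- inside `T`, and `e` bounds those seen from each outside vertex.
      ≤⟨ +-mono-≤ (subst (_≤ _) (NK-induced (suc (suc k)) G T) (proj₁ bounds))
           (sum-map-≤ _ {e} (λ v → ≤-trans (cliques-⊆ c (suc k) (filter-⊆ _ T))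
             (subst (_≤ e) (NK-induced (suc k) G T) (proj₂ bounds))) (Outside G T)) ⟩
    NK (suc (suc k)) D + length (Outside G T) * e
      ≡⟨ cong (λ z → NK (suc (suc k)) D + z * e) outside ⟩
    NK (suc (suc k)) D + m * e ∎
    where
    open ≤-Reasoning
    H = induced G T
    H-free : DFree F H
    H-free = complete-DFree G A-unique T-unique complete F (proj₁ G-free) (m+n≤o⇒m≤o f many)
    e≤H : e ≤ NK (suc k) H
    e≤H = subst (e ≤_) (sym (NK-induced (suc k) G T)) e≤T
    s+2≤A : suc (suc s) ≤ length A
    s+2≤A = m+n≤o⇒n≤o f many
    -- A larger `T` would be matched into `s + 1` vertices of `A`; a smaller one would span fewer
    -- than `e` cliques.
    T≡s : length T ≡ s
    T≡s = ≤-antisym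
      (≮⇒≥ λ s<T → no-matching (bipartite-matching G A-unique T-unique complete (≤-trans (n≤1+n _) s+2≤A) s<T))
      (≮⇒≥ λ T<s → <⇒≱ (NK-bound-< F k s e rich D-max T<s H H-free) e≤H)
    cover : Cover G T
    cover = complete-cover G A-unique T-unique complete
      (subst (λ t → ¬ Contains (Matching (suc t)) G) (sym T≡s) (proj₂ G-free))
      (subst (λ t → 2 + t ≤ length A) (sym T≡s) s+2≤A)
    bounds = InEXD-bounds F (suc k) D isDF T≡s H H-free e≤H
    outside : length (Outside G T) ≡ m
    outside = +-cancelʳ-≡ s _ _ (trans (cong (length (Outside G T) +_) (sym T≡s))
      (trans (length-Outside G T-unique) (+-comm s m)))

  NK-upper-bound : excess f s ≤ m → NK (suc (suc k)) G ≤ NK (suc (suc k)) D + m * e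
  NK-upper-bound excess≤m with matching-or-cover G (suc s)
  ... | inj₁ M = contradiction M no-matching
  ... | inj₂ (U , U-small , U-unique , U-cover) with twinBound f s * 2 ^ length U <? length A
    -- These are the vertices seeing at least `e` cliques; `suc (pred e)` matches the filter in
    -- `sum-map-≤-split` at `pred e`.
    where A = filter (λ v → suc (pred e) ≤? cliques c (suc k) (nbhd c v U)) (Outside G U)
  ...   | yes lt = twins-bound A′-unique T-unique complete (<⇒≤ many) e≤T
    where
    A = filter (λ v → suc (pred e) ≤? cliques c (suc k) (nbhd c v U)) (Outside G U)
    open Twins (twins c (twinBound f s) U A lt)
    A′-unique : Unique A′
    A′-unique = AllPairs-⊆ A′⊆A (Unique.filter⁺ _ (Unique.filter⁺ _ (Unique.allFin⁺ (s + m))))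
    T-unique : Unique T
    T-unique = AllPairs-⊆ T⊆U U-unique
    complete : CompleteTo G A′ T
    complete {v} v∈A′ t∈T = proj₂ (∈-filter⁻ _ {xs = U} (subst (_ ∈_) (sym (All.lookup nbrs v∈A′)) t∈T))
    v₀ : ∃ (_∈ A′)
    v₀ with A′ | many
    ... | v ∷ _ | _ = v , here refl
    -- A single twin suffices: it sees `e` cliques in `U`, all of them inside its neighbourhood `T`.
    e≤T : e ≤ cliques c (suc k) T
    e≤T = begin
      e                                          ≡⟨ suc-pred-e ⟨
      suc (pred e)                               ≤⟨ All.lookup (All-resp-⊆ A′⊆A (All.all-filter _ (Outside G U)))
                                                      (proj₂ v₀) ⟩
      cliques c (suc k) (nbhd c (proj₁ v₀) U)    ≡⟨ cong (cliques c (suc k)) (All.lookup nbrs (proj₂ v₀)) ⟩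
      cliques c (suc k) T                        ∎
      where open ≤-Reasoning
  ...   | no ≮A = begin
    NK (suc (suc k)) G
      ≡⟨ NK-cover G (suc k) U-unique U-cover ⟩
    cliques c (suc (suc k)) U + sum (map d (Outside G U))
      ≤⟨ +-mono-≤ (bounded (suc (suc k)) U ≤-refl)
           (sum-map-≤-split d e′ P (λ v → bounded (suc k) (nbhd c v U) (length-filter _ U)) (Outside G U)) ⟩
    P + (length A * P + length (Outside G U) * e′)
      ≤⟨ +-monoʳ-≤ P (+-mono-≤ (*-monoˡ-≤ P (≤-trans (≮⇒≥ ≮A) (*-monoʳ-≤ B (^-monoʳ-≤ 2 U-small))))
           (*-monoˡ-≤ e′ (m+n≤o⇒m≤o (length (Outside G U)) (≤-reflexive (length-Outside G U-unique))))) ⟩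
    P + (B * P * P + (s + m) * e′)
      ≡⟨ regroup P (B * P * P) s m e′ ⟩
    (P + B * P * P + s * e′) + m * e′
      -- The terms independent of `m` fit into `m`, which is the saving of one clique for each of
      -- `m` vertices.
      ≤⟨ +-monoˡ-≤ (m * e′) (≤-trans (+-monoʳ-≤ (P + B * P * P) (*-monoʳ-≤ s e′≤)) excess≤m) ⟩
    m + m * e′
      ≡⟨ *-suc m e′ ⟨
    m * suc e′
      ≡⟨ cong (m *_) suc-pred-e ⟩
    m * e
      ≤⟨ m≤n+m _ _ ⟩
    NK (suc (suc k)) D + m * e ∎
    where
    open ≤-Reasoning
    e′ = pred e
    P = coverSubsets s
    B = twinBound f s
    d = λ v → cliques c (suc k) (nbhd c v U)
    A = filter (λ v → suc e′ ≤? d v) (Outside G U)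
    bounded : ∀ j L → length L ≤ length U → cliques c j L ≤ P
    bounded j L L≤U = ≤-trans (cliques≤2^ c j L) (^-monoʳ-≤ 2 (≤-trans L≤U U-small))
    e′≤ : e′ ≤ 2 ^ s
    e′≤ = begin
      e′                                 ≤⟨ pred[n]≤n ⟩
      e                                  ≡⟨ NK≡cliques (suc k) D ⟩
      cliques (adj D) (suc k) (allFin s) ≤⟨ cliques≤2^ (adj D) (suc k) (allFin s) ⟩
      2 ^ length (allFin s)              ≡⟨ cong (2 ^_) (length-tabulate {n = s} id) ⟩
      2 ^ s                              ∎
    regroup : ∀ P Q s m x → P + (Q + (s + m) * x) ≡ (P + Q + s * x) + m * x
    regroup = solve-∀

-- The extremal number

IsExFM-JoinEmpty : (F : Graph f) (k : ℕ) (D : Graph s) → IsDF F (suc (suc k)) D → f * s ^ k < NK (suc k) D →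
  ∀ m → excess f s ≤ m → IsExFM (s + m) (suc (suc k)) F s (NK (suc (suc k)) (JoinEmpty D m))
IsExFM-JoinEmpty F k D isDF rich m excess≤m =
  (JoinEmpty D m , (JoinEmpty-Free F D (proj₁ (proj₁ isDF)) m , JoinEmpty-MatchingFree D m) , refl)
  , λ G G-free → ≤-trans (NK-upper-bound F k D isDF rich m G G-free excess≤m)
      (≤-reflexive (sym (NK-JoinEmpty (suc k) D m)))

theorem1p3 : ∀ (r : ℕ) → 3 ≤ r → ∀ {f : ℕ} (F : Graph f) → ChromaticGreaterThan F r →
    Σ ℕ λ s₀ → ∀ (s : ℕ) → s₀ ≤ s →
    Σ ℕ λ n₀ → ∀ (n : ℕ) → n₀ ≤ n →
    ∀ (D : Graph s) → IsDF F r D →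
    IsExFM n r F s (NK r (JoinEmpty D (n ∸ s)))
-- Adding `s` to `excess f s` makes `n ∸ s` at least `excess f s` and `s + (n ∸ s)` equal to `n`.
theorem1p3 (suc (suc k)) _ {f} F χ>r = s₀ , λ s s₀≤s → excess f s + s , λ n n₀≤n D isDF →
  let E , E-colourable , E-rich = clique-rich s s₀≤s
      -- The multipartite graph `E` is D(F)-free, so `D` has at least as many cliques.
      rich = <-≤-trans E-rich (proj₂ (proj₁ isDF) E (colourable⇒DFree F χ>r E E-colourable))
  in subst (λ N → IsExFM N (suc (suc k)) F s (NK (suc (suc k)) (JoinEmpty D (n ∸ s))))
       (m+[n∸m]≡n (m+n≤o⇒n≤o (excess f s) n₀≤n))
       (IsExFM-JoinEmpty F k D isDF rich (n ∸ s) (m+n≤o⇒m≤o∸n (excess f s) n₀≤n))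
  where
  s₀ = proj₁ (clique-rich-colourable k f)
  clique-rich = proj₂ (clique-rich-colourable k f)
theorem1p3 (suc zero) (s≤s ()) F
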